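{- There is a category $\mathbf{Graph}_{CP}$ whose objects are connected graphs and whose morphisms are the cut-proper morphisms. There is a contravariant functor $\mathfrak C:\mathbf{Graph}_{CP}\to\mathbf{Bool}$ taking a connected graph $G$ to its cut algebra $\mathfrak C(G)$ and a cut-proper morphism $\phi:G_1\to G_2$ to a Boolean algebra homomorphism $\mathfrak C(\phi):\mathfrak C(G_2)\to\mathfrak C(G_1)$ such that $\mathfrak C(\phi)(A)=\phi^{ -1}(A)\in\mathfrak C(G_1)$ for every $A\in\mathfrak C(G_2)$. The same assignment $\mathfrak C$ is also a well-defined contravariant functor from the category $\mathbf{Graph}_{LP}$ of connected graphs with strongly line-proper morphisms to $\mathbf{Bool}$.
   Context: Graphs are simple and undirected, possibly infinite. A graph homomorphism is a map of vertex sets sending adjacent vertices to adjacent vertices; composition is composition of maps. $\mathbf{Bool}$ is the category of Boolean algebras (the one-element algebra is allowed) and Boolean algebra homomorphisms. Cut algebra: for a graph $G$, $\mathfrak c(G)$ is the Boolean algebra of sets $A\subset V(G)$ such that only finitely many edges join $A$ to $V(G)\setminus A$; $I_G$ is the ideal of finite sets of vertices all of which have finite degree; $\mathfrak C(G)=\mathfrak c(G)/I_G$ (elements $A,B$ are identified when $A\,\Delta\,B\in I_G$). Elements of $\mathfrak C(G)$ are denoted by any of their representatives. Cut-proper: a graph homomorphism $\phi:G_1\to G_2$ is cut-proper if $\phi^{ -1}:\mathfrak C(G_2)\to\mathfrak C(G_1)$ is well defined, i.e. if (i) whenever $A\subset V(G_2)$ is joined to $V(G_2)\setminus A$ by only finitely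 many edges, $\phi^{ -1}(A)$ is joined to $\phi^{ -1}(V(G_2)\setminus A)$ by only finitely many edges; and (ii) whenever $v\in V(G_2)$ has finite degree, $\phi^{ -1}(v)$ is a finite set of vertices of finite degree. Strongly line-proper: a graph homomorphism $\phi:G_1\to G_2$ between connected graphs is strongly line-proper if for every edge $e\in E(G_2)$ the set of edges $\{u,v\}\in E(G_1)$ with $\{\phi(u),\phi(v)\}=e$ is finite. -}

module Defs where

open import Level using (Level; _⊔_) renaming (suc to lsuc)
open import Data.List.Base using (List; []; _++_)
import Data.List.Membership.Setoid as Membership
import Data.List.Membership.Setoid.Properties as Membershipₚ
open import Data.Product using (∃; Σ-syntax; _×_; _,_; proj₁; proj₂)
open import Data.Sum.Base using (_⊎_; inj₁; inj₂; [_,_]′)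
open import Data.Empty.Polymorphic using (⊥-elim)
open import Data.Unit.Polymorphic using (tt)
open import Function.Base using (case_of_) renaming (id to idᶠ; _∘_ to _∘ᶠ_)
open import Relation.Binary.Core using (Rel)
open import Relation.Binary.Bundles using (Setoid)
open import Relation.Binary.Structures using (IsEquivalence)
open import Relation.Binary.Definitions using (Symmetric; Irreflexive)
open import Relation.Binary.Construct.Closure.ReflexiveTransitive using (Star)
open import Relation.Binary.PropositionalEquality
  using (_≡_; _≗_; refl; sym; trans; setoid)
open import Relation.Nullary.Negation using (¬_; contradiction)
open import Relation.Nullary.Decidable using (yes; no; ¬¬-excluded-middle)
open import Relation.Unary using (Pred; _∈_; _∉_; _⊆_; _≐_; ∁; _∪_; _∩_; _∖_; _⊢_)
open import Relation.Unary.Polymorphic using (∅; U)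
import Relation.Unary.Algebra as Sets
open import Algebra.Core using (Op₁; Op₂)
open import Algebra.Lattice.Bundles using (BooleanAlgebra)
open import Algebra.Lattice.Structures using (IsBooleanAlgebra)
open import Algebra.Lattice.Morphism.Structures using (IsLatticeHomomorphism)

private
  variable
    a b p q r o h e o′ h′ e′ ℓ : Level

-- P is finite if some list contains every element of P.  No decidability
-- is assumed of P or of the equality, so the list and the memberships are
-- asserted only up to double negation; under excluded middle this is the
-- usual notion of finiteness.
Finite : (S : Setoid a b) → Pred (Setoid.Carrier S) p → Set (a ⊔ b ⊔ p)
Finite S P = ¬ ¬ (∃ λ xs → ∀ {x} → x ∈ P → ¬ ¬ (x ∈ₗ xs))
  where open Membership S using () renaming (_∈_ to _∈ₗ_)

module _ (S : Setoid a b) where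
  open Membership S using () renaming (_∈_ to _∈ₗ_)
  open Membershipₚ using (∈-++⁺ˡ; ∈-++⁺ʳ)

  Finite-empty : {P : Pred (Setoid.Carrier S) p} → (∀ {x} → x ∉ P) → Finite S P
  Finite-empty ∉P k = k ([] , λ x∈P → contradiction x∈P ∉P)

  -- A set covered, classically, by two finite sets is finite.
  Finite-cover : {P : Pred (Setoid.Carrier S) p} {Q : Pred (Setoid.Carrier S) q}
                 {R : Pred (Setoid.Carrier S) r} →
                 (∀ {x} → x ∈ P → ¬ ¬ (x ∈ Q ∪ R)) →
                 Finite S Q → Finite S R → Finite S P
  Finite-cover P⊆Q∪R finQ finR k =
    finQ λ (xs , Q⊆xs) → finR λ (ys , R⊆ys) →
    k (xs ++ ys , λ x∈P x∉ → P⊆Q∪R x∈P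
         [ (λ x∈Q → Q⊆xs x∈Q (x∉ ∘ᶠ ∈-++⁺ˡ S))
         , (λ x∈R → R⊆ys x∈R (x∉ ∘ᶠ ∈-++⁺ʳ S xs)) ]′)

  Finite-⊆ : {P : Pred (Setoid.Carrier S) p} {Q : Pred (Setoid.Carrier S) q} →
             (∀ {x} → x ∈ P → ¬ ¬ (x ∈ Q)) → Finite S Q → Finite S P
  Finite-⊆ P⊆Q finQ k =
    finQ λ (xs , Q⊆xs) →
    k (xs , λ x∈P x∉ → P⊆Q x∈P λ x∈Q → Q⊆xs x∈Q x∉)

record Graph (ℓ : Level) : Set (lsuc ℓ) where
  field
    Vertex     : Set ℓ
    Adj        : Rel Vertex ℓ
    adj-sym    : Symmetric Adj
    adj-irrefl : Irreflexive _≡_ Adj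

  -- An edge is stored with an arbitrary orientation; _≈ₑ_ forgets the
  -- orientation and the proof of adjacency.
  record Edge : Set ℓ where
    constructor edge
    field
      {source target} : Vertex
      adj             : Adj source target

  open Edge public

  _≈ₑ_ : Rel Edge ℓ
  e ≈ₑ f = (source e ≡ source f × target e ≡ target f)
         ⊎ (source e ≡ target f × target e ≡ source f)

  edges : Setoid ℓ ℓ
  edges = record
    { Carrier       = Edge
    ; _≈_           = _≈ₑ_
    ; isEquivalence = record
      { refl  = inj₁ (refl , refl)
      ; sym   = λ { (inj₁ (s , t)) → inj₁ (sym s , sym t)
                  ; (inj₂ (s , t)) → inj₂ (sym t , sym s) }
      ; trans = λ { (inj₁ (s , t)) (inj₁ (s′ , t′)) → inj₁ (trans s s′ , trans t t′)
                  ; (inj₁ (s , t)) (inj₂ (s′ , t′)) → inj₂ (trans s s′ , trans t t′)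
                  ; (inj₂ (s , t)) (inj₁ (s′ , t′)) → inj₂ (trans s t′ , trans t s′)
                  ; (inj₂ (s , t)) (inj₂ (s′ , t′)) → inj₁ (trans s t′ , trans t s′) }
      }
    }

  Connected : Set ℓ
  Connected = ∀ u v → Star Adj u v

  FiniteVertexSet : Pred Vertex ℓ → Set ℓ
  FiniteVertexSet = Finite (setoid Vertex)

  FiniteDegree : Pred Vertex ℓ
  FiniteDegree v = Finite edges (λ e → v ≡ source e ⊎ v ≡ target e)

  Cut : Pred Vertex ℓ → Pred Edge ℓ
  Cut A e = (source e ∈ A × target e ∉ A) ⊎ (target e ∈ A × source e ∉ A)

  FiniteCut : Pred Vertex ℓ → Set ℓ
  FiniteCut A = Finite edges (Cut A)

  -- The ideal I_G.
  Negligible : Pred Vertex ℓ → Set ℓ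
  Negligible S = FiniteVertexSet S × S ⊆ FiniteDegree

record ConnectedGraph (ℓ : Level) : Set (lsuc ℓ) where
  field
    graph     : Graph ℓ
    connected : Graph.Connected graph

_△_ : {A : Set a} → Pred A p → Pred A q → Pred A (p ⊔ q)
P △ Q = (P ∖ Q) ∪ (Q ∖ P)

module _ (G : Graph ℓ) where
  open Graph G

  -- An element of the quotient is given by a representative; the quotient is
  -- taken by the equality _≈ᶜ_.
  CutSet : Set (lsuc ℓ)
  CutSet = Σ[ A ∈ Pred Vertex ℓ ] FiniteCut A

  _≈ᶜ_ : Rel CutSet ℓ
  (A , _) ≈ᶜ (B , _) = Negligible (A △ B)

  _∪ᶜ_ _∩ᶜ_ : Op₂ CutSet
  (A , finA) ∪ᶜ (B , finB) = A ∪ B , Finite-cover edges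
    (λ { (inj₁ (inj₁ s∈A , t∉)) k → k (inj₁ (inj₁ (s∈A , t∉ ∘ᶠ inj₁)))
       ; (inj₁ (inj₂ s∈B , t∉)) k → k (inj₂ (inj₁ (s∈B , t∉ ∘ᶠ inj₂)))
       ; (inj₂ (inj₁ t∈A , s∉)) k → k (inj₁ (inj₂ (t∈A , s∉ ∘ᶠ inj₁)))
       ; (inj₂ (inj₂ t∈B , s∉)) k → k (inj₂ (inj₂ (t∈B , s∉ ∘ᶠ inj₂))) })
    finA finB
  (A , finA) ∩ᶜ (B , finB) = A ∩ B , Finite-cover edges
    (λ { (inj₁ ((s∈A , s∈B) , t∉)) k →
           k (inj₁ (inj₁ (s∈A , λ t∈A → k (inj₂ (inj₁ (s∈B , λ t∈B → t∉ (t∈A , t∈B)))))))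
       ; (inj₂ ((t∈A , t∈B) , s∉)) k →
           k (inj₁ (inj₂ (t∈A , λ s∈A → k (inj₂ (inj₂ (t∈B , λ s∈B → s∉ (s∈A , s∈B))))))) })
    finA finB

  ∁ᶜ : Op₁ CutSet
  ∁ᶜ (A , finA) = ∁ A , Finite-⊆ edges
    (λ { (inj₁ (s∉A , t∉∁A)) k → t∉∁A λ t∈A → k (inj₂ (t∈A , s∉A))
       ; (inj₂ (t∉A , s∉∁A)) k → s∉∁A λ s∈A → k (inj₁ (s∈A , t∉A)) })
    finA

  ⊤ᶜ ⊥ᶜ : CutSet
  ⊤ᶜ = U , Finite-empty edges
    (λ { (inj₁ (_ , t∉U)) → t∉U tt ; (inj₂ (_ , s∉U)) → s∉U tt })
  ⊥ᶜ = ∅ , Finite-empty edges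
    (λ { (inj₁ (s∈∅ , _)) → ⊥-elim s∈∅ ; (inj₂ (t∈∅ , _)) → ⊥-elim t∈∅ })

  private
    Negligible-cover : {S T R : Pred Vertex ℓ} →
                       (∀ {v} → v ∈ S → ¬ ¬ (v ∈ T ∪ R)) →
                       Negligible T → Negligible R → Negligible S
    Negligible-cover S⊆ (finT , T⊆) (finR , R⊆) =
      Finite-cover (setoid Vertex) S⊆ finT finR ,
      λ v∈S k → S⊆ v∈S [ (λ v∈T → T⊆ v∈T k) , (λ v∈R → R⊆ v∈R k) ]′

    Negligible-⊆ : {S T : Pred Vertex ℓ} → (∀ {v} → v ∈ S → ¬ ¬ (v ∈ T)) →
                   Negligible T → Negligible S
    Negligible-⊆ S⊆T (finT , T⊆) =
      Finite-⊆ (setoid Vertex) S⊆T finT , λ v∈S k → S⊆T v∈S λ v∈T → T⊆ v∈T k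

    -- Sets which are classically equal define the same element.
    ≈-from : (X Y : CutSet) →
             (∀ {v} → v ∈ proj₁ X → ¬ ¬ (v ∈ proj₁ Y)) → proj₁ Y ⊆ proj₁ X → X ≈ᶜ Y
    ≈-from X Y X⊆Y Y⊆X =
      Finite-empty (setoid Vertex) ∉△ , λ v∈△ → contradiction v∈△ ∉△
      where
      ∉△ : ∀ {v} → v ∉ (proj₁ X △ proj₁ Y)
      ∉△ (inj₁ (v∈X , v∉Y)) = X⊆Y v∈X v∉Y
      ∉△ (inj₂ (v∈Y , v∉X)) = v∉X (Y⊆X v∈Y)

    ≐⇒≈ : (X Y : CutSet) → proj₁ X ≐ proj₁ Y → X ≈ᶜ Y
    ≐⇒≈ X Y (X⊆Y , Y⊆X) = ≈-from X Y (λ v∈X k → k (X⊆Y v∈X)) Y⊆X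

    ≈-sym : (X Y : CutSet) → X ≈ᶜ Y → Y ≈ᶜ X
    ≈-sym X Y = Negligible-⊆
      λ { (inj₁ d) k → k (inj₂ d) ; (inj₂ d) k → k (inj₁ d) }

    ≈-trans : (X Y Z : CutSet) → X ≈ᶜ Y → Y ≈ᶜ Z → X ≈ᶜ Z
    ≈-trans X Y Z = Negligible-cover
      λ { {v} (inj₁ (v∈X , v∉Z)) k → ¬¬-excluded-middle {A = v ∈ proj₁ Y} λ where
            (yes v∈Y) → k (inj₂ (inj₁ (v∈Y , v∉Z)))
            (no  v∉Y) → k (inj₁ (inj₁ (v∈X , v∉Y)))
        ; {v} (inj₂ (v∈Z , v∉X)) k → ¬¬-excluded-middle {A = v ∈ proj₁ Y} λ where
            (yes v∈Y) → k (inj₁ (inj₂ (v∈Y , v∉X)))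
            (no  v∉Y) → k (inj₂ (inj₂ (v∈Z , v∉Y))) }

    ∪-cong : (X X′ Y Y′ : CutSet) → X ≈ᶜ X′ → Y ≈ᶜ Y′ → (X ∪ᶜ Y) ≈ᶜ (X′ ∪ᶜ Y′)
    ∪-cong X X′ Y Y′ = Negligible-cover
      λ { (inj₁ (inj₁ x , ∉)) k → k (inj₁ (inj₁ (x , ∉ ∘ᶠ inj₁)))
        ; (inj₁ (inj₂ y , ∉)) k → k (inj₂ (inj₁ (y , ∉ ∘ᶠ inj₂)))
        ; (inj₂ (inj₁ x , ∉)) k → k (inj₁ (inj₂ (x , ∉ ∘ᶠ inj₁)))
        ; (inj₂ (inj₂ y , ∉)) k → k (inj₂ (inj₂ (y , ∉ ∘ᶠ inj₂))) }

    ∩-cong : (X X′ Y Y′ : CutSet) → X ≈ᶜ X′ → Y ≈ᶜ Y′ → (X ∩ᶜ Y) ≈ᶜ (X′ ∩ᶜ Y′)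
    ∩-cong X X′ Y Y′ = Negligible-cover
      λ { (inj₁ ((x , y) , ∉)) k →
            k (inj₁ (inj₁ (x , λ x′ → k (inj₂ (inj₁ (y , λ y′ → ∉ (x′ , y′)))))))
        ; (inj₂ ((x , y) , ∉)) k →
            k (inj₁ (inj₂ (x , λ x′ → k (inj₂ (inj₂ (y , λ y′ → ∉ (x′ , y′))))))) }

    ∁-cong : (X Y : CutSet) → X ≈ᶜ Y → ∁ᶜ X ≈ᶜ ∁ᶜ Y
    ∁-cong X Y = Negligible-⊆
      λ { (inj₁ (v∉X , v∉∁Y)) k → v∉∁Y λ v∈Y → k (inj₂ (v∈Y , v∉X))
        ; (inj₂ (v∉Y , v∉∁X)) k → v∉∁X λ v∈X → k (inj₁ (v∈X , v∉Y)) }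

    ∪-inverseˡ : (X : CutSet) → (∁ᶜ X ∪ᶜ X) ≈ᶜ ⊤ᶜ
    ∪-inverseˡ X = ≈-sym ⊤ᶜ (∁ᶜ X ∪ᶜ X)
      (≈-from ⊤ᶜ (∁ᶜ X ∪ᶜ X) (λ _ k → k (inj₁ (k ∘ᶠ inj₂))) (λ _ → tt))

    ∪-inverseʳ : (X : CutSet) → (X ∪ᶜ ∁ᶜ X) ≈ᶜ ⊤ᶜ
    ∪-inverseʳ X = ≈-sym ⊤ᶜ (X ∪ᶜ ∁ᶜ X)
      (≈-from ⊤ᶜ (X ∪ᶜ ∁ᶜ X) (λ _ k → k (inj₂ (k ∘ᶠ inj₁))) (λ _ → tt))

    cutAlgebra-isBooleanAlgebra : IsBooleanAlgebra _≈ᶜ_ _∪ᶜ_ _∩ᶜ_ ∁ᶜ ⊤ᶜ ⊥ᶜ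
    cutAlgebra-isBooleanAlgebra = record
      { isDistributiveLattice = record
        { isLattice = record
          { isEquivalence = record
            { refl  = λ {X} → ≐⇒≈ X X (idᶠ , idᶠ)
            ; sym   = λ {X} {Y} → ≈-sym X Y
            ; trans = λ {X} {Y} {Z} → ≈-trans X Y Z
            }
          ; ∨-comm     = λ X Y → ≐⇒≈ (X ∪ᶜ Y) (Y ∪ᶜ X) (Sets.∪-comm _ _)
          ; ∨-assoc    = λ X Y Z → ≐⇒≈ ((X ∪ᶜ Y) ∪ᶜ Z) (X ∪ᶜ (Y ∪ᶜ Z)) (Sets.∪-assoc _ _ _)
          ; ∨-cong     = λ {X} {X′} {Y} {Y′} → ∪-cong X X′ Y Y′
          ; ∧-comm     = λ X Y → ≐⇒≈ (X ∩ᶜ Y) (Y ∩ᶜ X) (Sets.∩-comm _ _)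
          ; ∧-assoc    = λ X Y Z → ≐⇒≈ ((X ∩ᶜ Y) ∩ᶜ Z) (X ∩ᶜ (Y ∩ᶜ Z)) (Sets.∩-assoc _ _ _)
          ; ∧-cong     = λ {X} {X′} {Y} {Y′} → ∩-cong X X′ Y Y′
          ; absorptive = (λ X Y → ≐⇒≈ (X ∪ᶜ (X ∩ᶜ Y)) X (Sets.∪-abs-∩ _ _))
                       , (λ X Y → ≐⇒≈ (X ∩ᶜ (X ∪ᶜ Y)) X (Sets.∩-abs-∪ _ _))
          }
        ; ∨-distrib-∧ =
            (λ X Y Z → ≐⇒≈ (X ∪ᶜ (Y ∩ᶜ Z)) ((X ∪ᶜ Y) ∩ᶜ (X ∪ᶜ Z)) (Sets.∪-distribˡ-∩ _ _ _))
          , (λ X Y Z → ≐⇒≈ ((Y ∩ᶜ Z) ∪ᶜ X) ((Y ∪ᶜ X) ∩ᶜ (Z ∪ᶜ X)) (Sets.∪-distribʳ-∩ _ _ _))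
        ; ∧-distrib-∨ =
            (λ X Y Z → ≐⇒≈ (X ∩ᶜ (Y ∪ᶜ Z)) ((X ∩ᶜ Y) ∪ᶜ (X ∩ᶜ Z)) (Sets.∩-distribˡ-∪ _ _ _))
          , (λ X Y Z → ≐⇒≈ ((Y ∪ᶜ Z) ∩ᶜ X) ((Y ∩ᶜ X) ∪ᶜ (Z ∩ᶜ X)) (Sets.∩-distribʳ-∪ _ _ _))
        }
      ; ∨-complement = ∪-inverseˡ , ∪-inverseʳ
      ; ∧-complement =
          (λ X → ≐⇒≈ (∁ᶜ X ∩ᶜ X) ⊥ᶜ
                   ((λ (v∉X , v∈X) → contradiction v∈X v∉X) , λ v∈∅ → ⊥-elim v∈∅))
        , (λ X → ≐⇒≈ (X ∩ᶜ ∁ᶜ X) ⊥ᶜ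
                   ((λ (v∈X , v∉X) → contradiction v∈X v∉X) , λ v∈∅ → ⊥-elim v∈∅))
      ; ¬-cong = λ {X} {Y} → ∁-cong X Y
      }

  cutAlgebra : BooleanAlgebra (lsuc ℓ) ℓ
  cutAlgebra = record { isBooleanAlgebra = cutAlgebra-isBooleanAlgebra }

ℭ : ConnectedGraph ℓ → BooleanAlgebra (lsuc ℓ) ℓ
ℭ G = cutAlgebra (ConnectedGraph.graph G)

record GraphHom (G₁ G₂ : Graph ℓ) : Set ℓ where
  private
    module G₁ = Graph G₁
    module G₂ = Graph G₂
  field
    map     : G₁.Vertex → G₂.Vertex
    map-adj : ∀ {u v} → G₁.Adj u v → G₂.Adj (map u) (map v)

  mapEdge : G₁.Edge → G₂.Edge
  mapEdge e = G₂.edge (map-adj (G₁.adj e))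

CutProper : {G₁ G₂ : Graph ℓ} → GraphHom G₁ G₂ → Set (lsuc ℓ)
CutProper {G₁ = G₁} {G₂ = G₂} φ =
    (∀ A → G₂.FiniteCut A → G₁.FiniteCut (map ⊢ A))
  × (∀ v → G₂.FiniteDegree v →
       G₁.FiniteVertexSet (map ⊢ (_≡ v)) × (map ⊢ (_≡ v)) ⊆ G₁.FiniteDegree)
  where
  module G₁ = Graph G₁
  module G₂ = Graph G₂
  open GraphHom φ

StronglyLineProper : {G₁ G₂ : Graph ℓ} → GraphHom G₁ G₂ → Set ℓ
StronglyLineProper {G₁ = G₁} {G₂ = G₂} φ =
  ∀ (e : G₂.Edge) → Finite G₁.edges (λ f → mapEdge f G₂.≈ₑ e)
  where
  module G₁ = Graph G₁
  module G₂ = Graph G₂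
  open GraphHom φ

-- A category with prescribed objects, morphisms and equality of morphisms.
record Category {Obj : Set o} (_⇒_ : Obj → Obj → Set h)
                (_≈_ : ∀ {A B} → Rel (A ⇒ B) e) : Set (o ⊔ h ⊔ e) where
  infixr 9 _∘_
  field
    id            : ∀ {A} → A ⇒ A
    _∘_           : ∀ {A B C} → B ⇒ C → A ⇒ B → A ⇒ C
    isEquivalence : ∀ {A B} → IsEquivalence (_≈_ {A} {B})
    ∘-cong        : ∀ {A B C} {g g′ : B ⇒ C} {f f′ : A ⇒ B} →
                    g ≈ g′ → f ≈ f′ → (g ∘ f) ≈ (g′ ∘ f′)
    identityˡ     : ∀ {A B} (f : A ⇒ B) → (id ∘ f) ≈ f
    identityʳ     : ∀ {A B} (f : A ⇒ B) → (f ∘ id) ≈ f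
    assoc         : ∀ {A B C D} (h : C ⇒ D) (g : B ⇒ C) (f : A ⇒ B) →
                    ((h ∘ g) ∘ f) ≈ (h ∘ (g ∘ f))

-- A contravariant functor with prescribed action F₀ on objects.
record ContravariantFunctor
         {Obj : Set o} {_⇒_ : Obj → Obj → Set h} {_≈_ : ∀ {A B} → Rel (A ⇒ B) e}
         {Obj′ : Set o′} {_⇒′_ : Obj′ → Obj′ → Set h′} {_≈′_ : ∀ {A B} → Rel (A ⇒′ B) e′}
         (C : Category _⇒_ _≈_) (D : Category _⇒′_ _≈′_) (F₀ : Obj → Obj′)
         : Set (o ⊔ h ⊔ e ⊔ h′ ⊔ e′) where
  private
    module C = Category C
    module D = Category D
  field
    F₁           : ∀ {A B} → A ⇒ B → F₀ B ⇒′ F₀ A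
    F-cong       : ∀ {A B} {f g : A ⇒ B} → f ≈ g → F₁ f ≈′ F₁ g
    identity     : ∀ {A} → F₁ (C.id {A}) ≈′ D.id
    homomorphism : ∀ {A B C} (g : B ⇒ C) (f : A ⇒ B) →
                   F₁ (g C.∘ f) ≈′ (F₁ f D.∘ F₁ g)

record BooleanHom (B₁ B₂ : BooleanAlgebra a b) : Set (a ⊔ b) where
  private
    module B₁ = BooleanAlgebra B₁
    module B₂ = BooleanAlgebra B₂
  field
    ⟦_⟧                   : B₁.Carrier → B₂.Carrier
    isLatticeHomomorphism : IsLatticeHomomorphism B₁.rawLattice B₂.rawLattice ⟦_⟧
    ¬-homo                : ∀ x → ⟦ B₁.¬ x ⟧ B₂.≈ B₂.¬ ⟦ x ⟧
    ⊤-homo                : ⟦ B₁.⊤ ⟧ B₂.≈ B₂.⊤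
    ⊥-homo                : ⟦ B₁.⊥ ⟧ B₂.≈ B₂.⊥

  open IsLatticeHomomorphism isLatticeHomomorphism public

_≈ᵇ_ : {B₁ B₂ : BooleanAlgebra a b} → Rel (BooleanHom B₁ B₂) (a ⊔ b)
_≈ᵇ_ {B₂ = B₂} f g = ∀ x → BooleanHom.⟦ f ⟧ x ≈ BooleanHom.⟦ g ⟧ x
  where open BooleanAlgebra B₂

BooleanAlgebras : (a b : Level) → Category (BooleanHom {a} {b}) _≈ᵇ_
BooleanAlgebras a b = record
  { id = λ {A} → let open BooleanAlgebra A renaming (refl to ≈-refl) in record
    { ⟦_⟧                   = idᶠ
    ; isLatticeHomomorphism = record
      { isRelHomomorphism = record { cong = idᶠ }
      ; ∧-homo            = λ _ _ → ≈-refl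
      ; ∨-homo            = λ _ _ → ≈-refl
      }
    ; ¬-homo = λ _ → ≈-refl
    ; ⊤-homo = ≈-refl
    ; ⊥-homo = ≈-refl
    }
  ; _∘_ = λ {A} {B} {C} g f →
      let open BooleanAlgebra C using () renaming (trans to _⨾_)
          module f = BooleanHom f
          module g = BooleanHom g
      in record
    { ⟦_⟧                   = g.⟦_⟧ ∘ᶠ f.⟦_⟧
    ; isLatticeHomomorphism = record
      { isRelHomomorphism = record { cong = g.⟦⟧-cong ∘ᶠ f.⟦⟧-cong }
      ; ∧-homo            = λ x y → g.⟦⟧-cong (f.∧-homo x y) ⨾ g.∧-homo _ _
      ; ∨-homo            = λ x y → g.⟦⟧-cong (f.∨-homo x y) ⨾ g.∨-homo _ _
      }
    ; ¬-homo = λ x → g.⟦⟧-cong (f.¬-homo x) ⨾ g.¬-homo _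
    ; ⊤-homo = g.⟦⟧-cong f.⊤-homo ⨾ g.⊤-homo
    ; ⊥-homo = g.⟦⟧-cong f.⊥-homo ⨾ g.⊥-homo
    }
  ; isEquivalence = λ {A} {B} → let module B = BooleanAlgebra B in record
    { refl  = λ _ → B.refl
    ; sym   = λ f≈g x → B.sym (f≈g x)
    ; trans = λ f≈g g≈h x → B.trans (f≈g x) (g≈h x)
    }
  ; ∘-cong = λ {A} {B} {C} {g} {g′} {f} {f′} g≈g′ f≈f′ x →
      BooleanAlgebra.trans C (BooleanHom.⟦⟧-cong g (f≈f′ x)) (g≈g′ _)
  ; identityˡ = λ {A} {B} _ _ → BooleanAlgebra.refl B
  ; identityʳ = λ {A} {B} _ _ → BooleanAlgebra.refl B
  ; assoc     = λ {A} {B} {C} {D} _ _ _ _ → BooleanAlgebra.refl D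
  }

HomProperty : (ℓ p : Level) → Set (lsuc ℓ ⊔ lsuc p)
HomProperty ℓ p = {G₁ G₂ : Graph ℓ} → GraphHom G₁ G₂ → Set p

module _ (P : HomProperty ℓ p) where

  record Hom (G₁ G₂ : ConnectedGraph ℓ) : Set (ℓ ⊔ p) where
    private
      module G₁ = ConnectedGraph G₁
      module G₂ = ConnectedGraph G₂
    field
      hom      : GraphHom G₁.graph G₂.graph
      property : P hom

    open GraphHom hom public

  _≈ʰ_ : {G₁ G₂ : ConnectedGraph ℓ} → Rel (Hom G₁ G₂) ℓ
  φ ≈ʰ ψ = Hom.map φ ≗ Hom.map ψ

  -- A category of connected graphs and homomorphisms satisfying P, in which
  -- composition is composition of maps.
  record GraphCategory : Set (lsuc ℓ ⊔ p) where
    field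
      category : Category Hom _≈ʰ_

    open Category category public

    field
      id-map : ∀ {G} → Hom.map (id {G}) ≗ idᶠ
      ∘-map  : ∀ {G₁ G₂ G₃} (ψ : Hom G₂ G₃) (φ : Hom G₁ G₂) →
               Hom.map (ψ ∘ φ) ≗ Hom.map ψ ∘ᶠ Hom.map φ

  -- A contravariant functor sending G to ℭ G and φ to φ⁻¹.
  record CutAlgebraFunctor (C : GraphCategory) : Set (lsuc ℓ ⊔ p) where
    field
      functor : ContravariantFunctor (GraphCategory.category C) (BooleanAlgebras (lsuc ℓ) ℓ) ℭ

    open ContravariantFunctor functor public

    field
      F₁-preimage : ∀ {G₁ G₂ : ConnectedGraph ℓ} (φ : Hom G₁ G₂)
                    (A : BooleanAlgebra.Carrier (ℭ G₂)) →
                    let open BooleanAlgebra (ℭ G₁) using (_≈_)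
                        open Graph (ConnectedGraph.graph G₁) using (FiniteCut)
                    in Σ[ fin ∈ FiniteCut (Hom.map φ ⊢ proj₁ A) ]
                         BooleanHom.⟦ F₁ φ ⟧ A ≈ (Hom.map φ ⊢ proj₁ A , fin)

{-# OPTIONS --safe #-}

-- Pulling back along a map with finite fibres preserves finiteness.  For a
-- cut-proper φ this shows that φ⁻¹ maps I_{G₂} into I_{G₁}, so φ⁻¹ descends to
-- the quotients; it commutes with the Boolean operations on the nose.  If φ is
-- strongly line-proper, the same principle applied to the map on edges shows
-- that the cut of φ⁻¹(A), and the set of edges meeting φ⁻¹(v) for v of finite
-- degree, are finite.  As G₁ is connected, either every vertex of φ⁻¹(v) is an
-- endpoint of an edge or G₁ is a single vertex, so φ⁻¹(v) is finite and φ is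
-- cut-proper.

module Submission where

open import Defs
open import Level using (Level)
open import Algebra.Lattice.Bundles using (BooleanAlgebra)
open import Data.List.Base using ([]; _∷_; [_])
import Data.List.Membership.Setoid as Membership
open import Data.List.Relation.Unary.Any using (here; there)
open import Data.Product using (Σ-syntax; ∃; _×_; _,_; proj₁; proj₂)
open import Data.Sum.Base using (_⊎_; inj₁; inj₂)
import Data.Sum.Base as Sum
open import Function.Base using () renaming (id to idᶠ; _∘_ to _∘ᶠ_)
open import Relation.Binary.Bundles using (Setoid)
open import Relation.Binary.Core using (REL)
open import Relation.Binary.Construct.Closure.ReflexiveTransitive using (Star; ε; _◅_)
open import Relation.Binary.PropositionalEquality
  using (_≡_; _≗_; refl; sym; trans; cong; subst; setoid)
open import Relation.Nullary.Negation using (contradiction)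
open import Relation.Nullary.Decidable using (yes; no; ¬¬-excluded-middle)
open import Relation.Unary using (Pred; _∈_; _∉_; _⊢_)

private
  variable
    a b c d p q r ℓ : Level

-- Finiteness of unions and preimages.

module _ (S : Setoid a b) where
  open Setoid S

  Finite-singleton : ∀ x → Finite S (_≈ x)
  Finite-singleton x k = k ([ x ] , λ y≈x ∉ → ∉ (here y≈x))

  module _ (T : Setoid c d) where
    private
      module T = Setoid T
    open Membership T using () renaming (_∈_ to _∈ₗ_)

    -- Induction on a list covering `Q`. Membership in that list holds only up to `T._≈_`, so `R`
    -- has to respect it.
    Finite-⋃ : {Q : Pred T.Carrier q} {R : REL T.Carrier Carrier r} →
               (∀ {y z x} → y T.≈ z → R y x → R z x) →
               (∀ {y} → y ∈ Q → Finite S (R y)) →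
               Finite T Q → Finite S (λ x → ∃ λ y → y ∈ Q × R y x)
    Finite-⋃ {Q = Q} {R} R-resp finR finQ k =
      finQ λ (ys , Q⊆ys) →
      Finite-⊆ S (λ (y , y∈Q , yRx) k′ → Q⊆ys y∈Q λ y∈ys → k′ (y , y∈Q , yRx , y∈ys))
        (union ys) k
      where
      -- The listed y need not lie in Q; only a y equal to an element of Q
      -- contributes, and then its R-class is that of the element of Q.
      union-at : ∀ z → Finite S (λ x → ∃ λ y → y ∈ Q × R y x × y T.≈ z)
      union-at z k = Finite-empty S
        -- Finiteness is a negation, so a refutation `k` may be assumed. Any element then supplies a
        -- `y` in `Q` whose finite class covers the set, against `k`; hence the set is empty, and so
        -- finite.
        (λ (_ , y∈Q , _ , y≈z) → Finite-⊆ S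
          (λ (_ , _ , y′Rx , y′≈z) k′ → k′ (R-resp (T.trans y′≈z (T.sym y≈z)) y′Rx))
          (finR y∈Q) k)
        k

      union : ∀ ys → Finite S (λ x → ∃ λ y → y ∈ Q × R y x × y ∈ₗ ys)
      union []       = Finite-empty S λ { (_ , _ , _ , ()) }
      union (z ∷ ys) = Finite-cover S
        (λ { (y , y∈Q , yRx , here  y≈z)  k → k (inj₁ (y , y∈Q , yRx , y≈z))
           ; (y , y∈Q , yRx , there y∈ys) k → k (inj₂ (y , y∈Q , yRx , y∈ys)) })
        (union-at z) (union ys)

    -- The preimage is the union of the fibres over `Q`.
    Finite-preimage : {Q : Pred T.Carrier q} (f : Carrier → T.Carrier) →
                      (∀ {y} → y ∈ Q → Finite S (λ x → f x T.≈ y)) →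
                      Finite T Q → Finite S (f ⊢ Q)
    Finite-preimage f fin finQ = Finite-⊆ S
      (λ fx∈Q k → k (_ , fx∈Q , T.refl))
      (Finite-⋃ (λ y≈z fx≈y → T.trans fx≈y y≈z) fin finQ)

-- The Boolean homomorphism of a cut-proper map.

module _ {G₁ G₂ : Graph ℓ} {φ : GraphHom G₁ G₂} (cp : CutProper φ) where
  private
    module G₁ = Graph G₁
    module G₂ = Graph G₂
  open GraphHom φ

  Negligible-preimage : {S : Pred G₂.Vertex ℓ} →
                        G₂.Negligible S → G₁.Negligible (map ⊢ S)
  Negligible-preimage (finS , S⊆) =
    Finite-preimage (setoid _) (setoid _) map (λ v∈S → proj₁ (proj₂ cp _ (S⊆ v∈S))) finS ,
    λ φu∈S → proj₂ (proj₂ cp _ (S⊆ φu∈S)) refl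

  preimageᶜ : CutSet G₂ → CutSet G₁
  preimageᶜ (A , finA) = map ⊢ A , proj₁ cp A finA

  preimageHom : BooleanHom (cutAlgebra G₂) (cutAlgebra G₁)
  preimageHom = record
    { ⟦_⟧                   = preimageᶜ
    ; isLatticeHomomorphism = record
      { isRelHomomorphism = record { cong = Negligible-preimage }
      -- Both sides have the same underlying set; `_≈ᶜ_` ignores the finiteness proofs.
      ; ∧-homo            = λ X Y → B.refl {preimageᶜ (_∩ᶜ_ G₂ X Y)}
      ; ∨-homo            = λ X Y → B.refl {preimageᶜ (_∪ᶜ_ G₂ X Y)}
      }
    ; ¬-homo = λ X → B.refl {preimageᶜ (∁ᶜ G₂ X)}
    ; ⊤-homo = B.refl {preimageᶜ (⊤ᶜ G₂)}
    ; ⊥-homo = B.refl {preimageᶜ (⊥ᶜ G₂)}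
    }
    where
    module B = BooleanAlgebra (cutAlgebra G₁)

module _ (G : Graph ℓ) where
  open Graph G

  -- The functor laws reduce to this, since morphisms are compared pointwise: the symmetric
  -- difference is empty.
  preimage-≗ : {X : Set ℓ} {f g : Vertex → X} → f ≗ g → (A : Pred X ℓ) →
               Negligible ((f ⊢ A) △ (g ⊢ A))
  preimage-≗ {f = f} {g} f≗g A =
    Finite-empty (setoid Vertex) ∉△ , λ v∈△ → contradiction v∈△ ∉△
    where
    ∉△ : ∀ {v} → v ∉ ((f ⊢ A) △ (g ⊢ A))
    ∉△ (inj₁ (fv∈A , gv∉A)) = gv∉A (subst A (f≗g _) fv∈A)
    ∉△ (inj₂ (gv∈A , fv∉A)) = fv∉A (subst A (sym (f≗g _)) gv∈A)

-- Identities and composites.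

idHom : {G : Graph ℓ} → GraphHom G G
idHom = record { map = idᶠ ; map-adj = idᶠ }

infixr 9 _∘Hom_
_∘Hom_ : {G₁ G₂ G₃ : Graph ℓ} → GraphHom G₂ G₃ → GraphHom G₁ G₂ → GraphHom G₁ G₃
ψ ∘Hom φ = record
  { map     = GraphHom.map ψ ∘ᶠ GraphHom.map φ
  ; map-adj = λ uv → GraphHom.map-adj ψ (GraphHom.map-adj φ uv)
  }

CutProper-id : {G : Graph ℓ} → CutProper (idHom {G = G})
CutProper-id =
  (λ _ finA → finA) ,
  (λ v finv → Finite-singleton (setoid _) v , λ { refl → finv })

CutProper-∘ : {G₁ G₂ G₃ : Graph ℓ} {ψ : GraphHom G₂ G₃} {φ : GraphHom G₁ G₂} →
              CutProper ψ → CutProper φ → CutProper (ψ ∘Hom φ)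
CutProper-∘ {φ = φ} cpψ cpφ =
  (λ A finA → proj₁ cpφ _ (proj₁ cpψ A finA)) ,
  -- The fibre of `ψ` over `v` is negligible, and `φ` pulls negligible sets back to negligible sets.
  (λ v finv → Negligible-preimage {φ = φ} cpφ (proj₂ cpψ v finv))

StronglyLineProper-id : {G : Graph ℓ} → StronglyLineProper (idHom {G = G})
StronglyLineProper-id {G = G} e = Finite-singleton (Graph.edges G) e

StronglyLineProper-∘ : {G₁ G₂ G₃ : Graph ℓ} {ψ : GraphHom G₂ G₃} {φ : GraphHom G₁ G₂} →
                       StronglyLineProper ψ → StronglyLineProper φ →
                       StronglyLineProper (ψ ∘Hom φ)
StronglyLineProper-∘ {G₁ = G₁} {G₂} {φ = φ} lpψ lpφ e =
  Finite-preimage (Graph.edges G₁) (Graph.edges G₂) (GraphHom.mapEdge φ)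
    (λ {f} _ → lpφ f) (lpψ e)

-- From strongly line-proper to cut-proper.

module _ {G₁ G₂ : Graph ℓ} (connected : Graph.Connected G₁)
         {φ : GraphHom G₁ G₂} (lp : StronglyLineProper φ) where
  private
    module G₁ = Graph G₁
    module G₂ = Graph G₂
  open GraphHom φ

  private
    Incident : G₁.Edge → Pred G₁.Vertex ℓ
    Incident e u = u ≡ G₁.source e ⊎ u ≡ G₁.target e

    Incident-resp : ∀ {e f u} → e G₁.≈ₑ f → Incident e u → Incident f u
    Incident-resp (inj₁ (s , t)) = Sum.map (λ u≡ → trans u≡ s) (λ u≡ → trans u≡ t)
    Incident-resp (inj₂ (s , t)) =
      Sum.swap ∘ᶠ Sum.map (λ u≡ → trans u≡ s) (λ u≡ → trans u≡ t)

    preimage-edges : {Q : Pred G₂.Edge ℓ} → Finite G₂.edges Q → Finite G₁.edges (mapEdge ⊢ Q)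
    preimage-edges = Finite-preimage G₁.edges G₂.edges mapEdge (λ {f} _ → lp f)

    -- By unfolding, this is the preimage under `mapEdge` of the edges incident with `v`.
    EdgeOver : G₂.Vertex → Pred G₁.Edge ℓ
    EdgeOver v e = v ≡ map (G₁.source e) ⊎ v ≡ map (G₁.target e)

    incident⇒over : ∀ {u v e} → map u ≡ v → Incident e u → EdgeOver v e
    incident⇒over refl = Sum.map (cong map) (cong map)

    fibre-finite : ∀ {v} → Finite G₁.edges (EdgeOver v) → G₁.FiniteVertexSet (map ⊢ (_≡ v))
    fibre-finite {v} finE k = ¬¬-excluded-middle {A = ∃ λ u → ∀ e → u ∉ Incident e} λ
      -- By connectedness `u` is the only vertex, so `[ u ]` covers every fibre.
      { (yes (u , isolated)) → k ([ u ] , λ {w} _ ∉ → ∉ (here (only isolated (connected u w))))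
      ; (no  ∄isolated)      → Finite-⊆ (setoid _)
        -- Otherwise each `u` in the fibre is, up to double negation, an endpoint of an edge over
        -- `v`; these edges are finitely many with two endpoints each.
        (λ {u} φu≡v k′ → ∄isolated (u , λ e u∈e → k′ (e , incident⇒over {e = e} φu≡v u∈e , u∈e)))
        (Finite-⋃ (setoid _) G₁.edges
          (λ {e} {f} → Incident-resp {e} {f})
          (λ {e} _ → Finite-cover (setoid _) (λ u∈e k′ → k′ u∈e)
            (Finite-singleton (setoid _) (G₁.source e))
            (Finite-singleton (setoid _) (G₁.target e)))
          finE)
        k
      }
      where
      only : ∀ {u w} → (∀ e → u ∉ Incident e) → Star G₁.Adj u w → w ≡ u
      only isolated ε        = refl
      only isolated (uv ◅ _) = contradiction (inj₁ refl) (isolated (G₁.edge uv))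

  StronglyLineProper⇒CutProper : CutProper φ
  StronglyLineProper⇒CutProper =
    -- The cut of `map ⊢ A` is by definition `mapEdge ⊢ Cut A`.
    (λ _ → preimage-edges) ,
    (λ v finv →
      fibre-finite (preimage-edges finv) ,
      λ φu≡v → Finite-⊆ G₁.edges (λ {e} u∈e k → k (incident⇒over {e = e} φu≡v u∈e))
               (preimage-edges finv))

-- The categories and their functors.

module _ (P : HomProperty ℓ p) where

  graphCategory : (∀ {G} → P (idHom {G = G})) →
                  (∀ {G₁ G₂ G₃} {ψ : GraphHom G₂ G₃} {φ : GraphHom G₁ G₂} →
                   P ψ → P φ → P (ψ ∘Hom φ)) →
                  GraphCategory P
  graphCategory P-id P-∘ = record
    { category = record
      { id            = record { hom = idHom ; property = P-id }
      ; _∘_           = λ ψ φ → record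
        { hom      = Hom.hom ψ ∘Hom Hom.hom φ
        ; property = P-∘ (Hom.property ψ) (Hom.property φ)
        }
      ; isEquivalence = record
        { refl  = λ _ → refl
        ; sym   = λ φ≗ψ u → sym (φ≗ψ u)
        ; trans = λ φ≗ψ ψ≗χ u → trans (φ≗ψ u) (ψ≗χ u)
        }
      ; ∘-cong        = λ {_} {_} {_} {ψ} ψ≗ψ′ φ≗φ′ u →
                          trans (cong (Hom.map ψ) (φ≗φ′ u)) (ψ≗ψ′ _)
      ; identityˡ     = λ _ _ → refl
      ; identityʳ     = λ _ _ → refl
      ; assoc         = λ _ _ _ _ → refl
      }
    ; id-map = λ _ → refl
    ; ∘-map  = λ _ _ _ → refl
    }

  -- `P` enters only through cut-properness, so one construction serves both categories; identities
  -- and composites of `C` are known pointwise from `id-map` and `∘-map`.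
  cutAlgebraFunctor : (∀ {G₁ G₂} (φ : Hom P G₁ G₂) → CutProper (Hom.hom φ)) →
                      (C : GraphCategory P) → CutAlgebraFunctor P C
  cutAlgebraFunctor cutProper C = record
    { functor = record
      { F₁           = λ φ → preimageHom {φ = Hom.hom φ} (cutProper φ)
      ; F-cong       = λ {G₁} φ≗ψ (A , _) → preimage-≗ (graph G₁) φ≗ψ A
      ; identity     = λ {G} (A , _) → preimage-≗ (graph G) id-map A
      ; homomorphism = λ {G₁} ψ φ (A , _) → preimage-≗ (graph G₁) (∘-map ψ φ) A
      }
    ; F₁-preimage = λ {G₁} φ (A , finA) →
        proj₁ (cutProper φ) A finA , preimage-≗ (graph G₁) {f = Hom.map φ} (λ _ → refl) A
    }
    where
    open GraphCategory C using (id-map; ∘-map)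
    open ConnectedGraph using (graph)

theorem23 : (ℓ : Level) →
    (Σ[ Graph-CP ∈ GraphCategory {ℓ} CutProper ] CutAlgebraFunctor CutProper Graph-CP)
    × (Σ[ Graph-LP ∈ GraphCategory {ℓ} StronglyLineProper ] CutAlgebraFunctor StronglyLineProper Graph-LP)
theorem23 ℓ = (Graph-CP , cutAlgebraFunctor CutProper Hom.property Graph-CP)
            , (Graph-LP , cutAlgebraFunctor StronglyLineProper lp⇒cp Graph-LP)
  where
  Graph-CP : GraphCategory {ℓ} CutProper
  Graph-CP = graphCategory CutProper CutProper-id
    (λ {_} {_} {_} {ψ} {φ} → CutProper-∘ {ψ = ψ} {φ})

  Graph-LP : GraphCategory {ℓ} StronglyLineProper
  Graph-LP = graphCategory StronglyLineProper StronglyLineProper-id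
    (λ {_} {_} {_} {ψ} {φ} → StronglyLineProper-∘ {ψ = ψ} {φ})

  lp⇒cp : ∀ {G₁ G₂ : ConnectedGraph ℓ} (φ : Hom StronglyLineProper G₁ G₂) → CutProper (Hom.hom φ)
  lp⇒cp {G₁} φ = StronglyLineProper⇒CutProper
    (ConnectedGraph.connected G₁) {φ = Hom.hom φ} (Hom.property φ)
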